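{- Let $m$ be a positive integer, let $\phi:\mathbb{Z}\to\mathbb{Z}_m$ be the quotient morphism ($1\mapsto 1$) and $B\phi:\mathbb{S}^1\to B\mathbb{Z}_m$ its delooping. Define $L^0=0$ with the unique map $(B\phi)^{\ast 0}:L^0\to B\mathbb{Z}_m$, and $L^{n+1}=L^n\ast_{B\mathbb{Z}_m}\mathbb{S}^1$ with map $(B\phi)^{\ast(n+1)}=(B\phi)^{\ast n}\ast B\phi$. Let $R=\Sigma(x:\mathbb{S}^1).\Sigma(y:\mathbb{S}^1).(B\phi(x)=B\phi(y))$ with second projection $\mathrm{snd}:R\to\mathbb{S}^1$, $(x,y,p)\mapsto y$, and let $R^{\ast n}$ be the source of the $n$-fold iterated join of $\mathrm{snd}$ with itself over $\mathbb{S}^1$ (with $R^{\ast 0}=0$). Then for every $n\in\mathbb{N}$, $$L^n\times_{B\mathbb{Z}_m}\mathbb{S}^1 = R^{\ast n},$$ where the pullback is of $(B\phi)^{\ast n}$ and $B\phi$; consequently $L^{n+1}$ is the pushout of the span $L^n\leftarrow R^{\ast n}\to\mathbb{S}^1$ (the maps being the two pullback projections).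
   Context: Homotopy type theory; all (co)limits are homotopy (co)limits. A delooping $BG$ of a group $G$ is a pointed connected type with $\Omega BG=G$ as groups; group morphisms deloop uniquely to pointed maps; $\mathbb{S}^1$ is a delooping of $\mathbb{Z}$. Join of maps: for $f:A\to C$, $g:B\to C$, $A\times_C B=\Sigma(a:A).\Sigma(b:B).(f(a)=g(b))$, $A\ast_C B$ is the pushout of the two projections out of $A\times_C B$, and $f\ast g:A\ast_C B\to C$ is the induced map. Iterated joins are formed left to right starting from the map out of the empty type $0$. -}

{-# OPTIONS --without-K #-}
module Defs where

open import Algebra.Bundles using (Group; AbelianGroup)
open import Algebra.Bundles.Raw using (RawGroup)
open import Algebra.Morphism.Bundles using (GroupHomomorphism)
open import Algebra.Morphism.Structures using (IsGroupIsomorphism; IsGroupHomomorphism)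
import Algebra.Properties.Group as GroupProperties
open import Axiom.Extensionality.Propositional using (Extensionality)
open import Data.Empty using (⊥; ⊥-elim)
open import Data.Fin.Base using (Fin; toℕ; fromℕ<)
import Data.Fin.Properties as Fin
open import Data.Integer.Base using (ℤ; +_; -[1+_]; 0ℤ; 1ℤ; -_; _+_; _*_; _-_; ∣_∣) renaming (suc to sucℤ; pred to predℤ)
import Data.Integer.Properties as ℤ
open import Data.Integer.DivMod using (_%ℕ_; _/ℕ_; n%ℕd<d; a≡a%ℕn+[a/ℕn]*n)
open import Data.Integer.Tactic.RingSolver using (solve-∀)
open import Data.Nat.Base as ℕ using (ℕ; zero; suc; NonZero)
import Data.Nat.Properties as ℕ
open import Data.Product.Base using (Σ; Σ-syntax; ∃; _×_; _,_; proj₁; proj₂)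
open import Data.Sum.Base using (inj₁; inj₂)
open import Function.Base using (id; _∘_)
open import Level using (Level; 0ℓ; Setω)
open import Relation.Binary.PropositionalEquality
open import Relation.Nullary using (Irrelevant)

private
  variable
    a b : Level

-- _≡_ is the type of paths, which requires --without-K: with K, every type is
-- a set and the record HoTT below is uninhabited.

-- Bi-invertible maps; bi-invertibility is a proposition.
IsEquiv : {A : Set a} {B : Set b} → (A → B) → Set _
IsEquiv {A = A} {B = B} f =
  (Σ[ g ∈ (B → A) ] ∀ y → f (g y) ≡ y) × (Σ[ h ∈ (B → A) ] ∀ x → h (f x) ≡ x)

_≃_ : Set a → Set b → Set _
A ≃ B = Σ[ f ∈ (A → B) ] IsEquiv f

coe : {A B : Set a} → A ≡ B → A → B
coe = subst id

idToEquiv : {A B : Set a} → A ≡ B → A ≃ B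
idToEquiv p = coe p , (coe (sym p) , λ _ → subst-subst-sym p) , (coe (sym p) , λ _ → subst-sym-subst p)

-- The rules of homotopy type theory that are used here and that Agda without K
-- lacks.  The higher inductive types are given by their introduction
-- and elimination rules; the computation rules, also those for point
-- constructors, hold up to a path.
record HoTT : Setω where
  field
    univalence : {A B : Set a} → IsEquiv (idToEquiv {A = A} {B = B})

    funext : Extensionality a b

    ∥_∥       : Set → Set
    ∣_∣₋₁     : {A : Set} → A → ∥ A ∥
    ∥∥-isProp : {A : Set} → Irrelevant ∥ A ∥
    ∥∥-rec    : {A : Set} {P : Set a} → Irrelevant P → (A → P) → ∥ A ∥ → P

    S¹   : Set
    base : S¹
    loop : base ≡ base

    S¹-elim : (P : S¹ → Set a) (x : P base) → subst P loop x ≡ x → ∀ s → P s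
    S¹-elim-base : (P : S¹ → Set a) (x : P base) (l : subst P loop x ≡ x) →
                   S¹-elim P x l base ≡ x
    S¹-elim-loop : (P : S¹ → Set a) (x : P base) (l : subst P loop x ≡ x) →
                   dcong (S¹-elim P x l) loop ≡
                   trans (cong (subst P loop) (S¹-elim-base P x l))
                         (trans l (sym (S¹-elim-base P x l)))

    Pushout : {A B C : Set} → (C → A) → (C → B) → Set
    inl  : {A B C : Set} {f : C → A} {g : C → B} → A → Pushout f g
    inr  : {A B C : Set} {f : C → A} {g : C → B} → B → Pushout f g
    glue : {A B C : Set} {f : C → A} {g : C → B} → ∀ c → inl {f = f} {g = g} (f c) ≡ inr (g c)

    Pushout-elim : {A B C : Set} {f : C → A} {g : C → B} (P : Pushout f g → Set a)
                   (l : ∀ x → P (inl x)) (r : ∀ y → P (inr y)) →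
                   (∀ c → subst P (glue c) (l (f c)) ≡ r (g c)) → ∀ w → P w
    Pushout-elim-inl : {A B C : Set} {f : C → A} {g : C → B} (P : Pushout f g → Set a)
                       (l : ∀ x → P (inl x)) (r : ∀ y → P (inr y))
                       (h : ∀ c → subst P (glue c) (l (f c)) ≡ r (g c)) →
                       ∀ x → Pushout-elim P l r h (inl x) ≡ l x
    Pushout-elim-inr : {A B C : Set} {f : C → A} {g : C → B} (P : Pushout f g → Set a)
                       (l : ∀ x → P (inl x)) (r : ∀ y → P (inr y))
                       (h : ∀ c → subst P (glue c) (l (f c)) ≡ r (g c)) →
                       ∀ y → Pushout-elim P l r h (inr y) ≡ r y
    Pushout-elim-glue : {A B C : Set} {f : C → A} {g : C → B} (P : Pushout f g → Set a)
                        (l : ∀ x → P (inl x)) (r : ∀ y → P (inr y))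
                        (h : ∀ c → subst P (glue c) (l (f c)) ≡ r (g c)) →
                        ∀ c → dcong (Pushout-elim P l r h) (glue c) ≡
                              trans (cong (subst P (glue c)) (Pushout-elim-inl P l r h (f c)))
                                    (trans (h c) (sym (Pushout-elim-inr P l r h (g c))))

ℤ-group : Group 0ℓ 0ℓ
ℤ-group = AbelianGroup.group ℤ.+-0-abelianGroup

module _ (m : ℕ) .{{_ : NonZero m}} where

  -- Residue of an integer modulo m, in {0, …, m - 1} also for negative integers.
  residue : ℤ → Fin m
  residue k = fromℕ< (n%ℕd<d k m)

  private
    rep : Fin m → ℤ
    rep i = + toℕ i

    quot : ∀ k → k ≡ rep (residue k) + (k /ℕ m) * + m
    quot k = trans (a≡a%ℕn+[a/ℕn]*n k m)
                   (cong (λ r → + r + (k /ℕ m) * + m) (sym (Fin.toℕ-fromℕ< (n%ℕd<d k m))))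

    ∣i-j∣<m : ∀ (i j : Fin m) → ∣ rep i - rep j ∣ ℕ.< m
    ∣i-j∣<m i j rewrite ℤ.m-n≡m⊖n (toℕ i) (toℕ j) with ℕ.≤-total (toℕ i) (toℕ j)
    ... | inj₁ i≤j rewrite ℤ.∣⊖∣-≤ i≤j = ℕ.≤-<-trans (ℕ.m∸n≤m (toℕ j) (toℕ i)) (Fin.toℕ<n j)
    ... | inj₂ j≤i rewrite ℤ.⊖-≥ j≤i   = ℕ.≤-<-trans (ℕ.m∸n≤m (toℕ i) (toℕ j)) (Fin.toℕ<n i)

    small-multiple : ∀ k → ∣ k * + m ∣ ℕ.< m → k * + m ≡ 0ℤ
    small-multiple (+ zero) _ = refl
    small-multiple k@(+ suc n) lt = ⊥-elim (ℕ.<⇒≱ lt (subst (m ℕ.≤_) (sym (ℤ.abs-* k (+ m))) (ℕ.m≤m+n m (n ℕ.* m))))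
    small-multiple k@(-[1+ n ]) lt = ⊥-elim (ℕ.<⇒≱ lt (subst (m ℕ.≤_) (sym (ℤ.abs-* k (+ m))) (ℕ.m≤m+n m (n ℕ.* m))))

    rep-unique : ∀ i j k → rep i ≡ rep j + k * + m → i ≡ j
    rep-unique i j k eq = Fin.toℕ-injective (ℤ.+-injective (ℤ.i-j≡0⇒i≡j (rep i) (rep j)
      (trans diff (small-multiple k (subst (λ z → ∣ z ∣ ℕ.< m) diff (∣i-j∣<m i j))))))
      where
      cancel : ∀ x y → x + y - x ≡ y
      cancel = solve-∀
      diff : rep i - rep j ≡ k * + m
      diff = trans (cong (_- rep j) eq) (cancel (rep j) (k * + m))

    residue-unique : ∀ x j k → x ≡ rep j + k * + m → residue x ≡ j
    residue-unique x j k eq = rep-unique (residue x) j (k - q) (trans (sym (cancel (rep (residue x)) (q * + m)))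
        (trans (cong (_- q * + m) (trans (sym (quot x)) eq)) (collect (rep j) k q (+ m))))
      where
      q = x /ℕ m
      cancel : ∀ r s → r + s - s ≡ r
      cancel = solve-∀
      collect : ∀ r s t u → r + s * u - t * u ≡ r + (s - t) * u
      collect = solve-∀

    residue-cong : ∀ x y k → x ≡ y + k * + m → residue x ≡ residue y
    residue-cong x y k eq = residue-unique x (residue y) (y /ℕ m + k)
        (trans eq (trans (cong (_+ k * + m) (quot y)) (collect (rep (residue y)) (y /ℕ m) k (+ m))))
      where
      collect : ∀ r s t u → r + s * u + t * u ≡ r + (s + t) * u
      collect = solve-∀

    residue-rep : ∀ i → residue (rep i) ≡ i
    residue-rep i = residue-unique (rep i) i 0ℤ (sym (ℤ.+-identityʳ (rep i)))

  private
    infixl 6 _⊕_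

    _⊕_ : Fin m → Fin m → Fin m
    i ⊕ j = residue (rep i + rep j)

    neg : Fin m → Fin m
    neg i = residue (- rep i)

    ⊕-homo : ∀ x y → residue (x + y) ≡ residue x ⊕ residue y
    ⊕-homo x y = residue-cong (x + y) (rep (residue x) + rep (residue y)) (x /ℕ m + y /ℕ m)
        (trans (cong₂ _+_ (quot x) (quot y)) (collect (rep (residue x)) (rep (residue y)) (x /ℕ m) (y /ℕ m) (+ m)))
      where
      collect : ∀ r s t u v → r + t * v + (s + u * v) ≡ r + s + (t + u) * v
      collect = solve-∀

    neg-homo : ∀ x → residue (- x) ≡ neg (residue x)
    neg-homo x = residue-cong (- x) (- rep (residue x)) (- (x /ℕ m))
        (trans (cong -_ (quot x)) (collect (rep (residue x)) (x /ℕ m) (+ m)))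
      where
      collect : ∀ r s t → - (r + s * t) ≡ - r + (- s) * t
      collect = solve-∀

    ⊕-comm : ∀ i j → i ⊕ j ≡ j ⊕ i
    ⊕-comm i j = cong residue (ℤ.+-comm (rep i) (rep j))

    ⊕-assoc : ∀ i j k → (i ⊕ j) ⊕ k ≡ i ⊕ (j ⊕ k)
    ⊕-assoc i j k = begin
      (i ⊕ j) ⊕ k                                ≡⟨ cong ((i ⊕ j) ⊕_) (residue-rep k) ⟨
      (i ⊕ j) ⊕ residue (rep k)                  ≡⟨ ⊕-homo (rep i + rep j) (rep k) ⟨
      residue (rep i + rep j + rep k)            ≡⟨ cong residue (ℤ.+-assoc (rep i) (rep j) (rep k)) ⟩
      residue (rep i + (rep j + rep k))          ≡⟨ ⊕-homo (rep i) (rep j + rep k) ⟩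
      residue (rep i) ⊕ (j ⊕ k)                  ≡⟨ cong (_⊕ (j ⊕ k)) (residue-rep i) ⟩
      i ⊕ (j ⊕ k)                                ∎
      where open ≡-Reasoning

    ⊕-identityˡ : ∀ i → residue 0ℤ ⊕ i ≡ i
    ⊕-identityˡ i = begin
      residue 0ℤ ⊕ i               ≡⟨ cong (residue 0ℤ ⊕_) (residue-rep i) ⟨
      residue 0ℤ ⊕ residue (rep i) ≡⟨ ⊕-homo 0ℤ (rep i) ⟨
      residue (0ℤ + rep i)         ≡⟨ cong residue (ℤ.+-identityˡ (rep i)) ⟩
      residue (rep i)              ≡⟨ residue-rep i ⟩
      i                            ∎
      where open ≡-Reasoning

    ⊕-inverseˡ : ∀ i → (neg i) ⊕ i ≡ residue 0ℤ
    ⊕-inverseˡ i = begin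
      (neg i) ⊕ i                ≡⟨ cong ((neg i) ⊕_) (residue-rep i) ⟨
      (neg i) ⊕ residue (rep i)  ≡⟨ ⊕-homo (- rep i) (rep i) ⟨
      residue (- rep i + rep i) ≡⟨ cong residue (ℤ.+-inverseˡ (rep i)) ⟩
      residue 0ℤ               ∎
      where open ≡-Reasoning

  ℤ/ : Group 0ℓ 0ℓ
  ℤ/ = record
    { Carrier = Fin m
    ; _≈_     = _≡_
    ; _∙_     = _⊕_
    ; ε       = residue 0ℤ
    ; _⁻¹     = neg
    ; isGroup = record
      { isMonoid = record
        { isSemigroup = record
          { isMagma = record { isEquivalence = isEquivalence ; ∙-cong = cong₂ _⊕_ }
          ; assoc = ⊕-assoc
          }
        ; identity = ⊕-identityˡ , λ i → trans (⊕-comm i (residue 0ℤ)) (⊕-identityˡ i)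
        }
      ; inverse = ⊕-inverseˡ , λ i → trans (⊕-comm i (neg i)) (⊕-inverseˡ i)
      ; ⁻¹-cong = cong neg
      }
    }

  quotientHom : GroupHomomorphism (Group.rawGroup ℤ-group) (Group.rawGroup ℤ/)
  quotientHom = record
    { ⟦_⟧ = residue
    ; isGroupHomomorphism = record
      { isMonoidHomomorphism = record
        { isMagmaHomomorphism = record
          { isRelHomomorphism = record { cong = cong residue }
          ; homo = ⊕-homo
          }
        ; ε-homo = refl
        }
      ; ⁻¹-homo = neg-homo
      }
    }

module Theory (𝓗 : HoTT) where
  open HoTT 𝓗 public

  IsConnected : Set → Set
  IsConnected X = ∀ (x y : X) → ∥ x ≡ y ∥

  Ω : (X : Set) → X → RawGroup 0ℓ 0ℓ
  Ω X x = record
    { Carrier = x ≡ x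
    ; _≈_     = _≡_
    ; _∙_     = trans
    ; ε       = refl
    ; _⁻¹     = sym
    }

  record Delooping (G : Group 0ℓ 0ℓ) : Set₁ where
    field
      space     : Set
      point     : space
      connected : IsConnected space
      toΩ       : Group.Carrier G → point ≡ point
      toΩ-iso   : IsGroupIsomorphism (Group.rawGroup G) (Ω space point) toΩ

  -- A pointed map f : BG → BH with Ωf = φ under the identifications ΩBG = G
  -- and ΩBH = H.
  record MapDelooping {G H : Group 0ℓ 0ℓ} (BG : Delooping G) (BH : Delooping H)
                      (φ : GroupHomomorphism (Group.rawGroup G) (Group.rawGroup H)) : Set where
    private
      module BG = Delooping BG
      module BH = Delooping BH
    field
      fun       : BG.space → BH.space
      fun-point : fun BG.point ≡ BH.point
      Ω-fun     : ∀ g → trans (sym fun-point) (trans (cong fun (BG.toΩ g)) fun-point)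
                        ≡ BH.toΩ (GroupHomomorphism.⟦_⟧ φ g)

  loop^ : ℤ → base ≡ base
  loop^ (+ zero)     = refl
  loop^ (+ suc n)    = trans (loop^ (+ n)) loop
  loop^ -[1+ zero ]  = sym loop
  loop^ -[1+ suc n ] = trans (loop^ -[1+ n ]) (sym loop)

  private
    ua : {A B : Set} → A ≃ B → A ≡ B
    ua = proj₁ (proj₁ univalence)

    ua-β : {A B : Set} (e : A ≃ B) → coe (ua e) ≡ proj₁ e
    ua-β e = cong proj₁ (proj₂ (proj₁ univalence) e)

    trans-cancelʳ : {A : Set} {x y z : A} (p : x ≡ y) (q : z ≡ y) → trans (trans p (sym q)) q ≡ p
    trans-cancelʳ refl refl = refl

    trans-cancelʳ′ : {A : Set} {x y z : A} (p : x ≡ y) (q : y ≡ z) → trans (trans p q) (sym q) ≡ p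
    trans-cancelʳ′ refl refl = refl

    loop^-suc : ∀ i → loop^ (sucℤ i) ≡ trans (loop^ i) loop
    loop^-suc (+ n)        = refl
    loop^-suc -[1+ zero ]  = sym (trans-symˡ loop)
    loop^-suc -[1+ suc n ] = sym (trans-cancelʳ (loop^ -[1+ n ]) loop)

    loop^-pred : ∀ i → loop^ (predℤ i) ≡ trans (loop^ i) (sym loop)
    loop^-pred (+ zero)   = refl
    loop^-pred (+ suc n)  = sym (trans-cancelʳ′ (loop^ (+ n)) loop)
    loop^-pred -[1+ n ]   = refl

    +-sucʳ : ∀ i j → i + sucℤ j ≡ sucℤ (i + j)
    +-sucʳ i j = lem i j
      where
      lem : ∀ i j → i + (1ℤ + j) ≡ 1ℤ + (i + j)
      lem = solve-∀

    +-predʳ : ∀ i j → i + predℤ j ≡ predℤ (i + j)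
    +-predʳ i j = lem i j
      where
      lem : ∀ i j → i + (- 1ℤ + j) ≡ - 1ℤ + (i + j)
      lem = solve-∀

    Homo : ℤ → ℤ → Set
    Homo i j = loop^ (i + j) ≡ trans (loop^ i) (loop^ j)

    homo-suc : ∀ i j → Homo i j → loop^ (i + sucℤ j) ≡ trans (loop^ i) (trans (loop^ j) loop)
    homo-suc i j h = trans (cong loop^ (+-sucʳ i j)) (trans (loop^-suc (i + j))
      (trans (cong (λ p → trans p loop) h) (trans-assoc (loop^ i))))

    homo-pred : ∀ i j → Homo i j → loop^ (i + predℤ j) ≡ trans (loop^ i) (trans (loop^ j) (sym loop))
    homo-pred i j h = trans (cong loop^ (+-predʳ i j)) (trans (loop^-pred (i + j))
      (trans (cong (λ p → trans p (sym loop)) h) (trans-assoc (loop^ i))))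

    loop^-homo : ∀ i j → Homo i j
    loop^-homo i (+ zero)     = trans (cong loop^ (ℤ.+-identityʳ i)) (sym (trans-reflʳ (loop^ i)))
    loop^-homo i (+ suc n)    = homo-suc i (+ n) (loop^-homo i (+ n))
    loop^-homo i -[1+ zero ]  = homo-pred i 0ℤ (loop^-homo i 0ℤ)
    loop^-homo i -[1+ suc n ] = homo-pred i -[1+ n ] (loop^-homo i -[1+ n ])

    loop^-neg : ∀ i → loop^ (- i) ≡ sym (loop^ i)
    loop^-neg i = inverse (loop^ i) (loop^ (- i))
        (trans (sym (loop^-homo (- i) i)) (cong loop^ (ℤ.+-inverseˡ i)))
      where
      inverse : {A : Set} {x y : A} (p : x ≡ y) (q : y ≡ x) → trans q p ≡ refl → q ≡ sym p
      inverse refl q h = trans (sym (trans-reflʳ q)) h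

    sucEquiv : ℤ ≃ ℤ
    sucEquiv = sucℤ , (predℤ , ℤ.suc-pred) , (predℤ , ℤ.pred-suc)

    subst-const : {A : Set} {X : Set₁} {x y : A} (p : x ≡ y) (u : X) → subst (λ _ → X) p u ≡ u
    subst-const refl u = refl

    dcong-const : {A : Set} {X : Set₁} {x y : A} (f : A → X) (p : x ≡ y) →
                  dcong f p ≡ trans (subst-const p (f x)) (cong f p)
    dcong-const f refl = refl

    codeLoop : subst (λ _ → Set) loop ℤ ≡ ℤ
    codeLoop = trans (subst-const loop ℤ) (ua sucEquiv)

    code : S¹ → Set
    code = S¹-elim (λ _ → Set) ℤ codeLoop

    code-base : code base ≡ ℤ
    code-base = S¹-elim-base (λ _ → Set) ℤ codeLoop

    decodeℤ : code base → ℤ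
    decodeℤ = coe code-base

    -- Transport in `code` along `loop` is the successor.
    code-loop : ∀ c → decodeℤ (subst code loop c) ≡ sucℤ (decodeℤ c)
    code-loop c = begin
      coe β (subst code loop c)            ≡⟨ cong (coe β) (subst-∘ loop) ⟩
      coe β (coe (cong code loop) c)       ≡⟨ subst-subst (cong code loop) ⟩
      coe (trans (cong code loop) β) c     ≡⟨ cong (λ p → coe p c) square ⟩
      coe (trans β (ua sucEquiv)) c        ≡⟨ subst-subst β ⟨
      coe (ua sucEquiv) (coe β c)          ≡⟨ cong (λ f → f (coe β c)) (ua-β sucEquiv) ⟩
      sucℤ (coe β c)                       ∎
      where
      open ≡-Reasoning
      β = code-base

      lemma : {x y : S¹} (p : x ≡ y) {A A′ B : Set} (q : A ≡ A′) (r : A ≡ B)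
              (u : A′ ≡ B) →
              trans (subst-const p A) r ≡ trans (cong (subst (λ _ → Set) p) q) (trans (trans (subst-const p A′) u) refl) →
              r ≡ trans q u
      lemma refl refl r u h = trans h (trans-reflʳ u)

      lemma′ : {x y : S¹} (p : x ≡ y) {A A′ B B′ : Set} (q : A ≡ A′) (r : A ≡ B)
               (u : A′ ≡ B′) (s : B ≡ B′) →
               trans (subst-const p A) r ≡ trans (cong (subst (λ _ → Set) p) q) (trans (trans (subst-const p A′) u) (sym s)) →
               trans r s ≡ trans q u
      lemma′ p q r u refl h = trans (trans-reflʳ r) (lemma p q r u h)

      square : trans (cong code loop) β ≡ trans β (ua sucEquiv)
      square = lemma′ loop β (cong code loop) (ua sucEquiv) β
        (trans (sym (dcong-const code loop)) (S¹-elim-loop (λ _ → Set) ℤ codeLoop))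

    code-loop⁻¹ : ∀ c → decodeℤ (subst code (sym loop) c) ≡ predℤ (decodeℤ c)
    code-loop⁻¹ c = begin
      decodeℤ c′                              ≡⟨ ℤ.pred-suc (decodeℤ c′) ⟨
      predℤ (sucℤ (decodeℤ c′))               ≡⟨ cong predℤ (code-loop c′) ⟨
      predℤ (decodeℤ (subst code loop c′))    ≡⟨ cong (predℤ ∘ decodeℤ) (subst-subst-sym loop) ⟩
      predℤ (decodeℤ c)                       ∎
      where
      open ≡-Reasoning
      c′ = subst code (sym loop) c

    code-zero : code base
    code-zero = coe (sym code-base) 0ℤ

    encode : ∀ {x} → base ≡ x → code x
    encode p = subst code p code-zero

    winding : base ≡ base → ℤ
    winding p = decodeℤ (encode p)

    winding-suc : ∀ p → winding (trans p loop) ≡ sucℤ (winding p)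
    winding-suc p = trans (cong decodeℤ (sym (subst-subst p))) (code-loop (encode p))

    winding-pred : ∀ p → winding (trans p (sym loop)) ≡ predℤ (winding p)
    winding-pred p = trans (cong decodeℤ (sym (subst-subst p))) (code-loop⁻¹ (encode p))

    winding-loop^ : ∀ i → winding (loop^ i) ≡ i
    winding-loop^ (+ zero)     = subst-subst-sym code-base
    winding-loop^ (+ suc n)    = trans (winding-suc (loop^ (+ n))) (cong sucℤ (winding-loop^ (+ n)))
    winding-loop^ -[1+ zero ]  = trans (winding-pred refl) (cong predℤ (winding-loop^ 0ℤ))
    winding-loop^ -[1+ suc n ] = trans (winding-pred (loop^ -[1+ n ])) (cong predℤ (winding-loop^ -[1+ n ]))

    Decode : S¹ → Set
    Decode x = code x → base ≡ x

    decodeLoop : subst Decode loop (loop^ ∘ decodeℤ) ≡ loop^ ∘ decodeℤ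
    decodeLoop = funext λ c → let c′ = subst code (sym loop) c in begin
      subst Decode loop (loop^ ∘ decodeℤ) c                     ≡⟨ cong (subst Decode loop (loop^ ∘ decodeℤ)) (subst-subst-sym loop) ⟨
      subst Decode loop (loop^ ∘ decodeℤ) (subst code loop c′)  ≡⟨ move loop (loop^ ∘ decodeℤ) c′ ⟩
      trans (loop^ (decodeℤ c′)) loop                           ≡⟨ loop^-suc (decodeℤ c′) ⟨
      loop^ (sucℤ (decodeℤ c′))                                 ≡⟨ cong loop^ (code-loop c′) ⟨
      loop^ (decodeℤ (subst code loop c′))                      ≡⟨ cong (loop^ ∘ decodeℤ) (subst-subst-sym loop) ⟩
      loop^ (decodeℤ c)                                         ∎
      where
      open ≡-Reasoning
      move : ∀ {x y} (p : x ≡ y) (d : Decode x) c → subst Decode p d (subst code p c) ≡ trans (d c) p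
      move refl d c = sym (trans-reflʳ (d c))

    decode : ∀ x → Decode x
    decode = S¹-elim Decode (loop^ ∘ decodeℤ) decodeLoop

    decode-base : ∀ c → decode base c ≡ loop^ (decodeℤ c)
    decode-base c = cong (λ d → d c) (S¹-elim-base Decode (loop^ ∘ decodeℤ) decodeLoop)

    decode-encode : ∀ {x} (p : base ≡ x) → decode x (encode p) ≡ p
    decode-encode refl = trans (decode-base code-zero) (cong loop^ (subst-subst-sym code-base))

    loop^-winding : ∀ p → loop^ (winding p) ≡ p
    loop^-winding p = trans (sym (decode-base (encode p))) (decode-encode p)

    S¹-connected : IsConnected S¹
    S¹-connected = S¹-elim (λ x → ∀ y → ∥ x ≡ y ∥) from-base (funext λ _ → ∥∥-isProp _ _)
      where
      from-base : ∀ y → ∥ base ≡ y ∥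
      from-base = S¹-elim (λ y → ∥ base ≡ y ∥) ∣ refl ∣₋₁ (∥∥-isProp _ _)

  S¹-delooping : Delooping ℤ-group
  S¹-delooping = record
    { space     = S¹
    ; point     = base
    ; connected = S¹-connected
    ; toΩ       = loop^
    ; toΩ-iso   = record
      { isGroupMonomorphism = record
        { isGroupHomomorphism = record
          { isMonoidHomomorphism = record
            { isMagmaHomomorphism = record
              { isRelHomomorphism = record { cong = cong loop^ }
              ; homo = loop^-homo
              }
            ; ε-homo = refl
            }
          ; ⁻¹-homo = loop^-neg
          }
        ; injective = λ {i} {j} p →
            trans (sym (winding-loop^ i)) (trans (cong winding p) (winding-loop^ j))
        }
      ; surjective = λ p → winding p , λ { refl → loop^-winding p }
      }
    }

  module _ {A B C : Set} where

    Pullback : (A → C) → (B → C) → Set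
    Pullback f g = Σ[ x ∈ A ] Σ[ y ∈ B ] f x ≡ g y

    pr₁ : (f : A → C) (g : B → C) → Pullback f g → A
    pr₁ f g (x , _ , _) = x

    pr₂ : (f : A → C) (g : B → C) → Pullback f g → B
    pr₂ f g (_ , y , _) = y

    pr-square : (f : A → C) (g : B → C) (w : Pullback f g) → f (pr₁ f g w) ≡ g (pr₂ f g w)
    pr-square f g (_ , _ , p) = p

  Pushout-rec : {A B C X : Set} {f : C → A} {g : C → B} (i : A → X) (j : B → X) →
                (∀ c → i (f c) ≡ j (g c)) → Pushout f g → X
  Pushout-rec {X = X} {f = f} i j h =
    Pushout-elim (λ _ → X) i j (λ c → trans (const-subst (glue c) (i (f c))) (h c))
    where
    const-subst : {W : Set} {w w′ : W} (p : w ≡ w′) (x : X) → subst (λ _ → X) p x ≡ x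
    const-subst refl x = refl

  -- (X , i , j , h) is a pushout of A ←f- C -g→ B.
  IsPushout : {A B C X : Set} (f : C → A) (g : C → B) (i : A → X) (j : B → X) →
              (∀ c → i (f c) ≡ j (g c)) → Set
  IsPushout f g i j h = IsEquiv (Pushout-rec {f = f} {g = g} i j h)

  Join : {A B C : Set} → (A → C) → (B → C) → Set
  Join f g = Pushout (pr₁ f g) (pr₂ f g)

  joinMap : {A B C : Set} (f : A → C) (g : B → C) → Join f g → C
  joinMap f g = Pushout-rec f g (pr-square f g)

  -- The n-fold iterated join f^{∗n}, as its source together with its map to C.
  JoinPower    : {A C : Set} → (A → C) → ℕ → Set
  joinPowerMap : {A C : Set} (f : A → C) (n : ℕ) → JoinPower f n → C

  JoinPower f zero    = ⊥
  JoinPower f (suc n) = Join (joinPowerMap f n) f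

  joinPowerMap f zero    = ⊥-elim
  joinPowerMap f (suc n) = joinMap (joinPowerMap f n) f

  module Lens (m : ℕ) .{{_ : NonZero m}} (BZm : Delooping (ℤ/ m))
              (Bφ : MapDelooping S¹-delooping BZm (quotientHom m)) where

    bφ : S¹ → Delooping.space BZm
    bφ = MapDelooping.fun Bφ

    L : ℕ → Set
    L n = JoinPower bφ n

    bφ^∗ : ∀ n → L n → Delooping.space BZm
    bφ^∗ n = joinPowerMap bφ n

    R : Set
    R = Pullback bφ bφ

    sndR : R → S¹
    sndR = pr₂ bφ bφ

    R^∗ : ℕ → Set
    R^∗ n = JoinPower sndR n

    -- The pullback projections, after an identification e of the pullback
    -- with R^∗ n.
    module Span (n : ℕ) (e : Pullback (bφ^∗ n) bφ ≡ R^∗ n) where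

      toL : R^∗ n → L n
      toL r = pr₁ (bφ^∗ n) bφ (coe (sym e) r)

      toS¹ : R^∗ n → S¹
      toS¹ r = pr₂ (bφ^∗ n) bφ (coe (sym e) r)

      cocone : (r : R^∗ n) → inl (toL r) ≡ inr (toS¹ r)
      cocone r = glue {f = pr₁ (bφ^∗ n) bφ} {g = pr₂ (bφ^∗ n) bφ} (coe (sym e) r)

      L-suc-isPushout : Set
      L-suc-isPushout = IsPushout {X = L (suc n)} toL toS¹ inl inr cocone

{-# OPTIONS --safe #-}
{-# OPTIONS --without-K #-}
-- Every map into C is the projection of a total space Σ C F.  In terms of the
-- families F, the join over C is the fibrewise join and pulling back along k is
-- precomposition with k, so that the pullback of an n-fold join power is the
-- n-fold join power of the pullback.  Pulling bφ back along itself gives sndR.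
module Submission where

open import Data.Empty using (⊥; ⊥-elim)
open import Data.Nat.Base using (ℕ; zero; suc; NonZero)
open import Data.Product.Base using (Σ; Σ-syntax; _×_; _,_; proj₁; proj₂)
open import Function.Base using (id; _∘_)
open import Relation.Binary.PropositionalEquality
open import Defs

module _ (𝓗 : HoTT) where
  open Theory 𝓗

  private
    variable
      A B C D X Y : Set

  ua : A ≃ B → A ≡ B
  ua = proj₁ (proj₁ univalence)

  coe-ua : (e : A ≃ B) → coe (ua e) ≡ proj₁ e
  coe-ua e = cong proj₁ (proj₂ (proj₁ univalence) e)

  subst-const : {x y : A} (p : x ≡ y) (u : X) → subst (λ _ → X) p u ≡ u
  subst-const refl u = refl

  module _ {f : C → A} {g : C → B} where

    -- Induction into the family `u w ≡ v w`, where transport along `glue c` amounts to a commuting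
    -- square.
    Pushout-≡ : {u v : Pushout f g → X}
                (l : ∀ a → u (inl a) ≡ v (inl a)) (r : ∀ b → u (inr b) ≡ v (inr b)) →
                (∀ c → trans (l (f c)) (cong v (glue c)) ≡ trans (cong u (glue c)) (r (g c))) →
                ∀ w → u w ≡ v w
    Pushout-≡ {u = u} {v} l r sq =
      Pushout-elim (λ w → u w ≡ v w) l r (λ c → transport (glue c) (l (f c)) (r (g c)) (sq c))
      where
      transport : ∀ {w w′} (p : w ≡ w′) (s : u w ≡ v w) (t : u w′ ≡ v w′) →
                  trans s (cong v p) ≡ trans (cong u p) t → subst (λ w → u w ≡ v w) p s ≡ t
      transport refl s t sq = trans (sym (trans-reflʳ s)) sq

    module _ (i : A → X) (j : B → X) (h : ∀ c → i (f c) ≡ j (g c)) where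

      private
        rec : Pushout f g → X
        rec = Pushout-rec i j h

        -- Pushout-rec uses a local function to transport in a constant family.
        -- It cannot be named here; rec-elim lets unification find it.
        rec-elim : Σ[ s ∈ (∀ c → subst (λ _ → X) (glue c) (i (f c)) ≡ j (g c)) ]
                     rec ≡ Pushout-elim (λ _ → X) i j s
        rec-elim = _ , refl

        s : ∀ c → subst (λ _ → X) (glue c) (i (f c)) ≡ j (g c)
        s = proj₁ rec-elim

        s-const : ∀ c → s c ≡ trans (subst-const (glue c) (i (f c))) (h c)
        -- Abstracting `glue c` together with its endpoint turns it into a free path, on which
        -- induction is possible.
        s-const c with inr {f = f} {g} (g c) | glue {f = f} {g} c
        ... | _ | refl = refl

      rec-inl : ∀ a → Pushout-rec {f = f} {g} i j h (inl a) ≡ i a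
      rec-inl = Pushout-elim-inl (λ _ → X) i j s

      rec-inr : ∀ b → Pushout-rec {f = f} {g} i j h (inr b) ≡ j b
      rec-inr = Pushout-elim-inr (λ _ → X) i j s

      -- The dependent computation rule with the constant transport removed, as a square of the
      -- shape that `∘-rec` takes as hypothesis.
      rec-glue : ∀ c →
        trans (rec-inl (f c)) (h c) ≡ trans (cong (Pushout-rec i j h) (glue c)) (rec-inr (g c))
      rec-glue c = straighten (glue c) rec (rec-inl (f c)) (rec-inr (g c)) (s c) (s-const c)
                     (Pushout-elim-glue (λ _ → X) i j s c)
        where
        straighten : ∀ {w w′ : Pushout f g} (p : w ≡ w′) (k : Pushout f g → X) {x y}
                     (α : k w ≡ x) (β : k w′ ≡ y) {h : x ≡ y} (s : subst (λ _ → X) p x ≡ y) →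
                     s ≡ trans (subst-const p x) h →
                     dcong k p ≡ trans (cong (subst (λ _ → X) p) α) (trans s (sym β)) →
                     trans α h ≡ trans (cong k p) β
        straighten refl k refl β s refl eq =
          trans (lemma s β) (cong (λ q → trans q β) (sym eq))
          where
          lemma : ∀ {x y z : X} (s : x ≡ y) (β : z ≡ y) → s ≡ trans (trans s (sym β)) β
          lemma refl refl = refl

      -- The computation rules are absorbed here once, so the square to be checked involves `h` and
      -- not `Pushout-rec`. All later homotopies on pushouts come from this.
      ∘-rec : (φ : X → Y) {v : Pushout f g → Y}
              (l : ∀ a → φ (i a) ≡ v (inl a)) (r : ∀ b → φ (j b) ≡ v (inr b)) →
              (∀ c → trans (l (f c)) (cong v (glue c)) ≡ trans (cong φ (h c)) (r (g c))) →
              ∀ w → φ (Pushout-rec i j h w) ≡ v w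
      ∘-rec φ {v} l r sq =
        Pushout-≡ (λ a → trans (cong φ (rec-inl a)) (l a)) (λ b → trans (cong φ (rec-inr b)) (r b))
          λ c → paste (glue c) (rec-inl (f c)) (l (f c)) (h c) (rec-inr (g c)) (r (g c)) (rec-glue c) (sq c)
        where
        paste : ∀ {w w′ : Pushout f g} (p : w ≡ w′) {x y}
                (α : rec w ≡ x) (l : φ x ≡ v w) (h : x ≡ y) (β : rec w′ ≡ y) (r : φ y ≡ v w′) →
                trans α h ≡ trans (cong rec p) β →
                trans l (cong v p) ≡ trans (cong φ h) r →
                trans (trans (cong φ α) l) (cong v p) ≡ trans (cong (φ ∘ rec) p) (trans (cong φ β) r)
        paste refl refl l h β r refl sq = sq

  Pushout-isPushout : (f : C → A) (g : C → B) → IsPushout f g inl inr (glue {f = f} {g = g})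
  Pushout-isPushout f g = (id , rec-id) , (id , rec-id)
    where
    rec-id : ∀ w → Pushout-rec {f = f} {g} inl inr glue w ≡ w
    rec-id = ∘-rec inl inr (glue {f = f} {g}) id (λ _ → refl) (λ _ → refl) (λ _ → sym (trans-reflʳ _))

  -- By induction on `e`: at `refl` the reindexed span is the original one.
  isPushout-coe : {P : Set} (f : C → A) (g : C → B) (e : C ≡ P) →
    IsPushout (f ∘ coe (sym e)) (g ∘ coe (sym e)) inl inr (λ r → glue {f = f} {g = g} (coe (sym e) r))
  isPushout-coe f g refl = Pushout-isPushout f g

  -- Source and map are bundled so that `cong` can carry an equality through joins and pullbacks.
  MapTo : Set → Set₁
  MapTo C = Σ[ A ∈ Set ] (A → C)

  MapTo-≡ : {f : A → C} {g : B → C} (e : A ≃ B) →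
            (∀ x → f x ≡ g (proj₁ e x)) → _≡_ {A = MapTo C} (A , f) (B , g)
  MapTo-≡ {f = f} {g = g} e h = along (ua e) f g λ x → trans (h x) (cong (λ k → g (k x)) (sym (coe-ua e)))
    where
    along : (p : A ≡ B) (f : A → C) (g : B → C) →
            (∀ x → f x ≡ g (coe p x)) → _≡_ {A = MapTo C} (A , f) (B , g)
    along refl f g h = cong (_ ,_) (funext h)

  total : (C → Set) → MapTo C
  total {C} F = Σ C F , proj₁

  -- Each pair of a point `c` and a path `f a ≡ c` contracts to `f a` and `refl`.
  fibres : (f : A → C) → total (λ c → Σ[ a ∈ A ] f a ≡ c) ≡ (A , f)
  fibres f = MapTo-≡ (to , (from , λ _ → refl) , (from , λ where (_ , _ , refl) → refl))
                     (λ where (_ , _ , refl) → refl)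
    where
    to = λ (_ , a , _) → a
    from = λ a → f a , a , refl

  join : MapTo C → MapTo C → MapTo C
  join (_ , f) (_ , g) = Join f g , joinMap f g

  joinPower : MapTo C → ℕ → MapTo C
  joinPower (_ , f) n = JoinPower f n , joinPowerMap f n

  pullback : (D → C) → MapTo C → MapTo D
  pullback k (_ , f) = Pullback f k , pr₂ f k

  _⊛_ : Set → Set → Set
  X ⊛ Y = Pushout {C = X × Y} proj₁ proj₂

  _⊛^_ : Set → ℕ → Set
  X ⊛^ zero  = ⊥
  X ⊛^ suc n = (X ⊛^ n) ⊛ X

  module _ (F G : C → Set) where

    private
      f = proj₁ {B = F}
      g = proj₁ {B = G}

    toΣ-glue : (w : Pullback f g) → let ((c , x) , (c′ , y) , _) = w in
               _≡_ {A = Σ[ c ∈ C ] F c ⊛ G c} (c , inl x) (c′ , inr y)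
    toΣ-glue ((c , x) , (_ , y) , refl) = cong (c ,_) (glue (x , y))

    toΣ : Join f g → Σ[ c ∈ C ] F c ⊛ G c
    toΣ = Pushout-rec (λ (c , x) → c , inl x) (λ (c , y) → c , inr y) toΣ-glue

    fromΣ : ∀ c → F c ⊛ G c → Join f g
    fromΣ c = Pushout-rec (λ x → inl (c , x)) (λ y → inr (c , y)) (λ (x , y) → glue ((c , x) , (c , y) , refl))

    toΣ-fromΣ : ∀ c w → toΣ (fromΣ c w) ≡ (c , w)
    toΣ-fromΣ c = ∘-rec _ _ _ toΣ
      (λ x → rec-inl _ _ toΣ-glue (c , x))
      (λ y → rec-inr _ _ toΣ-glue (c , y))
      (λ (x , y) → rec-glue _ _ toΣ-glue ((c , x) , (c , y) , refl))

    fromΣ-toΣ : ∀ w → fromΣ (proj₁ (toΣ w)) (proj₂ (toΣ w)) ≡ w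
    fromΣ-toΣ = ∘-rec _ _ toΣ-glue (λ (c , w) → fromΣ c w)
      (λ (c , x) → rec-inl _ _ _ x)
      (λ (c , y) → rec-inr _ _ _ y)
      λ where
        ((c , x) , (_ , y) , refl) →
          -- Over a single `c`, `toΣ-glue` is the image of the fibre's glue, so the square is the
          -- computation rule of `fromΣ c`.
          trans (cong (trans (rec-inl _ _ _ x)) (cong-id (glue ((c , x) , (c , y) , refl))))
            (trans (rec-glue (λ x → inl (c , x)) (λ y → inr (c , y)) _ (x , y))
                   (cong (λ p → trans p (rec-inr _ _ _ y)) (cong-∘ (glue (x , y)))))

    joinMap-fromΣ : ∀ c w → joinMap f g (fromΣ c w) ≡ c
    joinMap-fromΣ c = ∘-rec _ _ _ (joinMap f g)
      (λ x → rec-inl _ _ _ (c , x))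
      (λ y → rec-inr _ _ _ (c , y))
      (λ (x , y) → trans (cong (trans _) (cong-const (glue (x , y))))
                         (rec-glue _ _ (pr-square f g) ((c , x) , (c , y) , refl)))
      where
      cong-const : {w w′ : X} (p : w ≡ w′) → cong (λ _ → c) p ≡ refl
      cong-const refl = refl

    -- `fromΣ` is the forward map because it respects the maps to `C` one fibre at a time, where the
    -- gluing path lies over `refl`.
    join-total : join (total F) (total G) ≡ total (λ c → F c ⊛ G c)
    join-total = sym (MapTo-≡
      ((λ (c , w) → fromΣ c w) ,
       (toΣ , fromΣ-toΣ) ,
       (toΣ , λ (c , w) → toΣ-fromΣ c w))
      (λ (c , w) → sym (joinMap-fromΣ c w)))

  joinPower-total : (F : C → Set) (n : ℕ) → joinPower (total F) n ≡ total (λ c → F c ⊛^ n)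
  joinPower-total F zero    = MapTo-≡ (⊥-elim , (proj₂ , λ ()) , (proj₂ , λ ())) λ ()
  joinPower-total F (suc n) =
    trans (cong (λ M → join M (total F)) (joinPower-total F n)) (join-total (λ c → F c ⊛^ n) F)

  -- The path from the base point to `k y` is contracted, leaving `y` and a point of `F (k y)`.
  pullback-total : (k : D → C) (F : C → Set) → pullback k (total F) ≡ total (F ∘ k)
  pullback-total k F = MapTo-≡
    (to , (from , λ _ → refl) , (from , λ where ((_ , _) , _ , refl) → refl))
    (λ where ((_ , _) , _ , refl) → refl)
    where
    to : Pullback proj₁ k → Σ _ (F ∘ k)
    to ((_ , x) , y , refl) = y , x
    from : Σ _ (F ∘ k) → Pullback proj₁ k
    from (y , x) = (k y , x) , y , refl

  pullback-joinPower-total : (k : D → C) (F : C → Set) (n : ℕ) →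
    pullback k (joinPower (total F) n) ≡ joinPower (pullback k (total F)) n
  pullback-joinPower-total k F n = begin
    pullback k (joinPower (total F) n)       ≡⟨ cong (pullback k) (joinPower-total F n) ⟩
    pullback k (total (λ c → F c ⊛^ n))      ≡⟨ pullback-total k (λ c → F c ⊛^ n) ⟩
    total (λ y → F (k y) ⊛^ n)               ≡⟨ joinPower-total (F ∘ k) n ⟨
    joinPower (total (F ∘ k)) n              ≡⟨ cong (λ M → joinPower M n) (pullback-total k F) ⟨
    joinPower (pullback k (total F)) n       ∎
    where open ≡-Reasoning

  pullback-joinPower : (k : D → C) (M : MapTo C) (n : ℕ) →
    pullback k (joinPower M n) ≡ joinPower (pullback k M) n
  pullback-joinPower k (_ , f) n =
    -- An arbitrary map is equal to the projection from the total space of its fibres, so the case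
    -- of projections suffices.
    subst (λ M → pullback k (joinPower M n) ≡ joinPower (pullback k M) n) (fibres f)
      (pullback-joinPower-total k _ n)

theorem7p10 : (𝓗 : HoTT) → let open Theory 𝓗 in
    (m : ℕ) .{{_ : NonZero m}}
    (BZm : Delooping (ℤ/ m))
    (Bφ : MapDelooping S¹-delooping BZm (quotientHom m)) →
    let open Lens m BZm Bφ in
    (n : ℕ) →
    Σ[ e ∈ (Pullback (bφ^∗ n) bφ ≡ R^∗ n) ] Span.L-suc-isPushout n e
theorem7p10 𝓗 m BZm Bφ n = e , isPushout-coe 𝓗 _ _ e
  where
  open Theory 𝓗
  open Lens m BZm Bφ
  e : Pullback (bφ^∗ n) bφ ≡ R^∗ n
  -- By definition `pullback bφ (S¹ , bφ)` is `R , sndR`; only the equality of sources is kept.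
  e = cong proj₁ (pullback-joinPower 𝓗 bφ (S¹ , bφ) n)
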